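{- Let $\mathcal G=(V,\mathcal E)$ be a temporal graph, $n=|V|$, and let $(\star)$ be one of the optimality criteria shortest, shortest-foremost, prefix-foremost. Let $s$ be drawn uniformly at random from $V$, and for $v\in V$ let $$\widetilde b^{(\star)}(v\mid s)=\frac1{n-1}\sum_{z\in V,\ z\ne s}\frac{\sigma^{(\star)}_{sz}(v)}{\sigma^{(\star)}_{sz}}.$$ Then $\widetilde b^{(\star)}(v\mid s)$ is an unbiased estimator of the $(\star)$-temporal betweenness centrality: $\mathbf E[\widetilde b^{(\star)}(v\mid s)]=\mathtt b^{(\star)}_v$ for every $v\in V$.
   Context: A (directed) temporal graph is $\mathcal G=(V,\mathcal E)$ with $V$ finite, $n=|V|\ge2$, and $\mathcal E$ a finite set of temporal edges $(u,v,t)$, $u,v\in V$, $t\in T=\{1,\dots,|T|\}$. A temporal path from $s$ to $z\ne s$ is a sequence $((u_1,t_1),\dots,(u_k,t_k))$ with $u_1=s$, $u_k=z$, $t_1=0$, $t_i<t_{i+1}$ and $(u_i,u_{i+1},t_{i+1})\in\mathcal E$. Its length is $k-1$, its arrival time $t_k$; it is foremost if no temporal path from $s$ to $z$ arrives earlier (the trivial path from $s$ to itself arrives at time $0$). $(\star)$-optimal means: shortest (minimum length), shortest-foremost (minimum length among foremost paths), or prefix-foremost (foremost with every prefix foremost). $\sigma^{(\star)}_{sz}$ is the number of $(\star)$-optimal temporal paths from $s$ to $z$ and $\sigma^{(\star)}_{sz}(v)$ the number of those passing through $v$ for $v\notin\{s,z\}$, with $\sigma^{(\star)}_{sz}(v)=0$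 if $v\in\{s,z\}$; the ratio $\sigma^{(\star)}_{sz}(v)/\sigma^{(\star)}_{sz}$ is $0$ if $\sigma^{(\star)}_{sz}=0$. The $(\star)$-temporal betweenness is $\mathtt b^{(\star)}_v=\frac1{n(n-1)}\sum_{s\ne v\ne z,\ s\ne z}\sigma^{(\star)}_{sz}(v)/\sigma^{(\star)}_{sz}$. -}

module Defs where

import Algebra.Properties.CommutativeMonoid.Sum as Sum
open import Data.Bool.Base using (if_then_else_)
open import Data.Fin.Base using (Fin)
import Data.Fin.Properties as Fin
open import Data.Integer.Base as ℤ using (+_; 1ℤ)
import Data.Integer.Properties as ℤ
open import Data.List.Base as List
  using (List; []; _∷_; concatMap; deduplicate; filter; inits)
import Data.List.Properties as List
open import Data.List.Membership.Propositional using (_∈_)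
open import Data.List.Membership.Propositional.Properties
  using (∈-concatMap⁺; ∈-deduplicate⁺; ∈-filter⁺; ∈-filter⁻; ∈-map⁺)
open import Data.List.NonEmpty as List⁺ using (List⁺; _∷_; head; last; tail; toList)
open import Data.List.Relation.Unary.All as All using (All)
open import Data.List.Relation.Unary.Any as Any using (Any; here; there; any?)
open import Data.List.Relation.Unary.Linked as Linked using (Linked; [-]; _∷_)
open import Data.List.Relation.Unary.Unique.Propositional using (Unique)
import Data.List.Relation.Unary.Unique.Propositional.Properties as Unique
import Data.List.Relation.Unary.Unique.DecPropositional.Properties as DecUnique
open import Data.Nat.Base as ℕ using (ℕ; zero; suc; _∸_; _≤_; _<_; s≤s)
import Data.Nat.Properties as ℕ
open import Data.Product.Base using (_×_; _,_; proj₁; proj₂; uncurry)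
import Data.Product.Properties as Product
open import Data.Rational.Base as ℚ using (ℚ; 0ℚ; 1ℚ; _/_; _+_; _*_; toℚᵘ; fromℚᵘ)
import Data.Rational.Properties as ℚ
open import Data.Rational.Unnormalised.Base as ℚᵘ using (mkℚᵘ; *≡*)
import Data.Rational.Unnormalised.Properties as ℚᵘ
open import Function.Base using (_∘_)
open import Function.Bundles using (_⇔_; mk⇔)
open import Level using (0ℓ)
open import Relation.Binary.Definitions using (DecidableEquality)
open import Relation.Binary.PropositionalEquality
  using (_≡_; refl; sym; trans; cong; cong₂; subst)
open import Relation.Nullary.Decidable
  using (Dec; does; map′; ¬?; _×-dec_; _⊎-dec_; _→-dec_)
open import Relation.Nullary.Negation using (contradiction)
open import Relation.Unary using (Pred; Decidable; _⊆_)

open Sum ℚ.+-0-commutativeMonoid using (sum; sum-syntax)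

sumWhere : ∀ {n} {P : Pred (Fin n) 0ℓ} → Decidable P → (Fin n → ℚ) → ℚ
sumWhere {n} P? f = ∑[ i < n ] (if does (P? i) then f i else 0ℚ)

syntax sumWhere P? (λ i → x) = ∑[ i ∣ P? ] x

record Distribution (n : ℕ) : Set where
  field
    weight  : Fin n → ℚ
    nonNeg  : ∀ i → 0ℚ ℚ.≤ weight i
    total≡1 : ∑[ i < n ] weight i ≡ 1ℚ

𝔼 : ∀ {n} → Distribution n → (Fin n → ℚ) → ℚ
𝔼 {n} μ X = ∑[ i < n ] (weight i * X i)
  where open Distribution μ

private
  1/+k/ : ∀ k d-1 → 1ℤ / suc d-1 + + k / suc d-1 ≡ + suc k / suc d-1
  1/+k/ k d-1 = ℚ.toℚᵘ-injective (begin
    toℚᵘ (fromℚᵘ x + fromℚᵘ y)               ≈⟨ ℚ.toℚᵘ-homo-+ (fromℚᵘ x) (fromℚᵘ y) ⟩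
    toℚᵘ (fromℚᵘ x) ℚᵘ.+ toℚᵘ (fromℚᵘ y)     ≈⟨ ℚᵘ.+-cong (ℚ.toℚᵘ-fromℚᵘ x) (ℚ.toℚᵘ-fromℚᵘ y) ⟩
    x ℚᵘ.+ y                                 ≈⟨ *≡* (trans (cong (ℤ._* d) (sym (ℤ.*-distribʳ-+ d 1ℤ (+ k))))
                                                           (ℤ.*-assoc (+ suc k) d d)) ⟩
    mkℚᵘ (+ suc k) d-1                       ≈⟨ ℚ.toℚᵘ-fromℚᵘ (mkℚᵘ (+ suc k) d-1) ⟨
    toℚᵘ (fromℚᵘ (mkℚᵘ (+ suc k) d-1))       ∎)
    where
    open import Relation.Binary.Reasoning.Setoid ℚᵘ.≃-setoid
    d = + suc d-1
    x = mkℚᵘ 1ℤ d-1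
    y = mkℚᵘ (+ k) d-1

  sum-1/ : ∀ k d-1 → ∑[ i < k ] (1ℤ / suc d-1) ≡ + k / suc d-1
  sum-1/ zero    d-1 = ℚ.fromℚᵘ-cong {mkℚᵘ (+ 0) 0} {mkℚᵘ (+ 0) d-1} (*≡* refl)
  sum-1/ (suc k) d-1 = trans (cong (λ q → 1ℤ / suc d-1 + q) (sum-1/ k d-1)) (1/+k/ k d-1)

uniform : ∀ n .{{_ : ℕ.NonZero n}} → Distribution n
uniform n@(suc n-1) = record
  { weight  = λ _ → 1ℤ / n
  ; nonNeg  = λ _ → ℚ.nonNegative⁻¹ (1ℤ / n) {{ℚ.normalize-nonNeg 1 n}}
  ; total≡1 = trans (sum-1/ n n-1)
                    (ℚ.fromℚᵘ-cong {mkℚᵘ (+ n) n-1} {mkℚᵘ 1ℤ 0} (*≡* (ℤ.*-comm (+ n) 1ℤ)))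
  }

record TemporalGraph : Set where
  field
    n        : ℕ
    2≤n      : 2 ≤ n
    lifetime : ℕ

  V : Set
  V = Fin n

  -- (u , v , t) is an edge from u to v at time t.  Only membership in
  -- the list matters, so it represents a finite set of temporal edges.
  field
    edges      : List (V × V × ℕ)
    edge-times : All (λ (_ , _ , t) → 1 ≤ t × t ≤ lifetime) edges

  instance
    n≢0 : ℕ.NonZero n
    n≢0 = ℕ.>-nonZero (ℕ.<-trans ℕ.z<s 2≤n)

    n-1≢0 : ℕ.NonZero (n ∸ 1)
    n-1≢0 = ℕ.>-nonZero (ℕ.∸-monoˡ-≤ 1 2≤n)

    n[n-1]≢0 : ℕ.NonZero (n ℕ.* (n ∸ 1))
    n[n-1]≢0 = ℕ.m*n≢0 n (n ∸ 1)

data Criterion : Set where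
  shortest shortestForemost prefixForemost : Criterion

module _ {A : Set} where

  Minimal : Pred A 0ℓ → (A → ℕ) → Pred A 0ℓ
  Minimal P f x = P x × (∀ y → P y → f x ≤ f y)

  minimal? : ∀ {P : Pred A 0ℓ} → Decidable P →
             (xs : List A) → P ⊆ (_∈ xs) →
             (f : A → ℕ) → Decidable (Minimal P f)
  minimal? P? xs P⊆xs f x =
    P? x ×-dec
    map′ (λ all y py → All.lookup all (P⊆xs py) py)
         (λ min → All.universal (λ y → min y) xs)
         (All.all? (λ y → P? y →-dec (f x ℕ.≤? f y)) xs)

  nonEmptyPrefixes : List⁺ A → List (List⁺ A)
  nonEmptyPrefixes (x ∷ xs) = List.map (x ∷_) (inits xs)

-- m / k, with the convention m / 0 = 0.
ratio : ℕ → ℕ → ℚ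
ratio m zero      = 0ℚ
ratio m k@(suc _) = + m / k

module _ (G : TemporalGraph) where
  open TemporalGraph G

  Path : Set
  Path = List⁺ (V × ℕ)

  endpoint : Path → V
  endpoint = proj₁ ∘ last

  arrival : Path → ℕ
  arrival = proj₂ ∘ last

  length : Path → ℕ
  length = List.length ∘ tail

  Step : V × ℕ → V × ℕ → Set
  Step (u , t) (v , t′) = t < t′ × (u , v , t′) ∈ edges

  -- The case s ≡ z is allowed so that the trivial path is covered; paths
  -- returning to s arrive after time 0, hence are never foremost.
  IsTemporalPath : V → V → Path → Set
  IsTemporalPath s z p =
    head p ≡ (s , 0) × endpoint p ≡ z × Linked Step (toList p)

  Foremost : V → V → Path → Set
  Foremost s z = Minimal (IsTemporalPath s z) arrival

  Optimal : Criterion → V → V → Path → Set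
  Optimal shortest         s z = Minimal (IsTemporalPath s z) length
  Optimal shortestForemost s z = Minimal (Foremost s z) length
  Optimal prefixForemost   s z p =
    Foremost s z p ×
    All (λ q → Foremost s (endpoint q) q) (nonEmptyPrefixes p)

  PassesThrough : V → Path → Set
  PassesThrough v p = Any (λ (u , _) → u ≡ v) (toList p)

  -- An overapproximation: Step is not checked here, but every temporal
  -- path from s is in walks lifetime (s , 0); see path∈candidates.
  walks : ℕ → V × ℕ → List Path
  walks zero       x = (x ∷ []) ∷ []
  walks (suc fuel) x =
    (x ∷ []) ∷
    concatMap (λ (_ , v , t) → List.map (λ p → x ∷ toList p) (walks fuel (v , t))) edges

  _≟ₙ_ : DecidableEquality (V × ℕ)
  _≟ₙ_ = Product.≡-dec Fin._≟_ ℕ._≟_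

  _≟ₑ_ : DecidableEquality (V × V × ℕ)
  _≟ₑ_ = Product.≡-dec Fin._≟_ _≟ₙ_

  _≟ₚ_ : DecidableEquality Path
  (x ∷ xs) ≟ₚ (y ∷ ys) =
    map′ (uncurry (cong₂ _∷_)) (λ { refl → refl , refl })
         (x ≟ₙ y ×-dec List.≡-dec _≟ₙ_ xs ys)

  candidates : V → List Path
  candidates s = deduplicate _≟ₚ_ (walks lifetime (s , 0))

  linked∈walks : ∀ fuel u t xs → lifetime ≤ t ℕ.+ fuel →
                 Linked Step ((u , t) ∷ xs) → ((u , t) ∷ xs) ∈ walks fuel (u , t)
  linked∈walks zero       u t []              _  _ = here refl
  linked∈walks (suc fuel) u t []              _  _ = here refl
  linked∈walks zero       u t ((v , t′) ∷ xs) le ((t<t′ , e∈) ∷ _) =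
    contradiction (proj₂ (All.lookup edge-times e∈))
      (ℕ.<⇒≱ (ℕ.≤-<-trans (subst (lifetime ≤_) (ℕ.+-identityʳ t) le) t<t′))
  linked∈walks (suc fuel) u t ((v , t′) ∷ xs) le ((t<t′ , e∈) ∷ steps) =
    there (∈-concatMap⁺ _ (Any.map (λ { refl → ∈-map⁺ _ ih }) e∈))
    where
    ih : ((v , t′) ∷ xs) ∈ walks fuel (v , t′)
    ih = linked∈walks fuel v t′ xs
      (ℕ.≤-trans le (subst (_≤ t′ ℕ.+ fuel) (sym (ℕ.+-suc t fuel))
                           (ℕ.+-monoˡ-≤ fuel t<t′)))
      steps

  path∈candidates : ∀ {s z} → IsTemporalPath s z ⊆ (_∈ candidates s)
  path∈candidates {s} {x = _ ∷ xs} (refl , _ , steps) =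
    ∈-deduplicate⁺ _≟ₚ_ (linked∈walks lifetime s 0 xs ℕ.≤-refl steps)

  isTemporalPath? : ∀ s z → Decidable (IsTemporalPath s z)
  isTemporalPath? s z p =
    (head p ≟ₙ (s , 0)) ×-dec (endpoint p Fin.≟ z) ×-dec
    Linked.linked? (λ (u , t) (v , t′) → (t ℕ.<? t′) ×-dec any? ((u , v , t′) ≟ₑ_) edges)
                   (toList p)

  foremost? : ∀ s z → Decidable (Foremost s z)
  foremost? s z = minimal? (isTemporalPath? s z) (candidates s) path∈candidates arrival

  optimal? : ∀ ★ s z → Decidable (Optimal ★ s z)
  optimal? shortest s z =
    minimal? (isTemporalPath? s z) (candidates s) path∈candidates length
  optimal? shortestForemost s z =
    minimal? (foremost? s z) (candidates s) (path∈candidates ∘ proj₁) length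
  optimal? prefixForemost s z p =
    foremost? s z p ×-dec
    All.all? (λ q → foremost? s (endpoint q) q) (nonEmptyPrefixes p)

  passesThrough? : ∀ v → Decidable (PassesThrough v)
  passesThrough? v p = any? (λ (u , _) → u Fin.≟ v) (toList p)

  optimalPaths : Criterion → V → V → List Path
  optimalPaths ★ s z = filter (optimal? ★ s z) (candidates s)

  optimal⇒path : ∀ ★ {s z} → Optimal ★ s z ⊆ IsTemporalPath s z
  optimal⇒path shortest         (path , _)       = path
  optimal⇒path shortestForemost ((path , _) , _) = path
  optimal⇒path prefixForemost   ((path , _) , _) = path

  -- These two facts justify counting optimal paths by list length.
  ∈-optimalPaths : ∀ ★ s z {p} → p ∈ optimalPaths ★ s z ⇔ Optimal ★ s z p
  ∈-optimalPaths ★ s z = mk⇔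
    (proj₂ ∘ ∈-filter⁻ (optimal? ★ s z) {xs = candidates s})
    (λ opt → ∈-filter⁺ (optimal? ★ s z) (path∈candidates (optimal⇒path ★ opt)) opt)

  optimalPaths-unique : ∀ ★ s z → Unique (optimalPaths ★ s z)
  optimalPaths-unique ★ s z =
    Unique.filter⁺ (optimal? ★ s z) (DecUnique.deduplicate-! _≟ₚ_ (walks lifetime (s , 0)))

  σ : Criterion → V → V → ℕ
  σ ★ s z = List.length (optimalPaths ★ s z)

  σ-through : Criterion → V → V → V → ℕ
  σ-through ★ s z v =
    if does ((v Fin.≟ s) ⊎-dec (v Fin.≟ z))
    then 0
    else List.length (filter (passesThrough? v) (optimalPaths ★ s z))

  betweenness : Criterion → V → ℚ
  betweenness ★ v =
    1ℤ / (n ℕ.* (n ∸ 1)) *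
    ∑[ s ∣ (λ s → ¬? (s Fin.≟ v)) ]
    ∑[ z ∣ (λ z → ¬? (v Fin.≟ z) ×-dec ¬? (s Fin.≟ z)) ]
      ratio (σ-through ★ s z v) (σ ★ s z)

  -- b̃(v ∣ s)
  estimator : Criterion → V → V → ℚ
  estimator ★ v s =
    1ℤ / (n ∸ 1) *
    ∑[ z ∣ (λ z → ¬? (z Fin.≟ s)) ]
      ratio (σ-through ★ s z v) (σ ★ s z)

{-# OPTIONS --safe #-}

-- The pairs (s , z) with v ∈ {s , z} contribute 0 to the estimator, because
-- σ_sz(v) = 0 there; hence the restrictions s ≠ v ≠ z in the definition of
-- betweenness can be dropped, and linearity of the sum does the rest.
module Submission where

open import Defs
open import Algebra.Bundles using (CommutativeRing)
import Algebra.Properties.CommutativeMonoid.Sum as MonoidSum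
import Algebra.Properties.Semiring.Sum as SemiringSum
open import Data.Bool.Base using (if_then_else_)
open import Data.Fin.Base using (Fin)
import Data.Fin.Properties as Fin
open import Data.Integer.Base using (+_; 1ℤ)
open import Data.Nat.Base as ℕ using (ℕ; zero; suc; _∸_)
open import Data.Product.Base using (_,_)
open import Data.Rational.Base using (ℚ; 0ℚ; _/_; _+_; _*_; toℚᵘ; fromℚᵘ)
import Data.Rational.Properties as ℚ
open import Data.Rational.Unnormalised.Base as ℚᵘ using (mkℚᵘ; *≡*)
import Data.Rational.Unnormalised.Properties as ℚᵘ
open import Data.Sum.Base using (_⊎_; inj₁; inj₂)
open import Function.Base using (_∘_)
open import Level using (0ℓ)
open import Relation.Binary.PropositionalEquality
  using (_≡_; _≗_; refl; sym; trans; cong; module ≡-Reasoning)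
open import Relation.Nullary.Decidable
  using (yes; no; does; dec-true; decidable-stable; ¬?; _×-dec_; _⊎-dec_)
open import Relation.Nullary.Negation using (¬_; contradiction)
open import Relation.Unary using (Pred; Decidable; _⊆_)
open import Relation.Unary.Properties using (U?)

open MonoidSum ℚ.+-0-commutativeMonoid
  using (sum; sum-cong-≗; sum-replicate-zero)
open SemiringSum (CommutativeRing.semiring ℚ.+-*-commutativeRing)
  using (*-distribˡ-sum)

-- Holds index by index: where the two decisions differ, `P ⊆ Q` leaves only the case of `Q` without
-- `P`, and there `f` is zero. Applied once to the targets `z` and once to the sources `s`.
sumWhere-restrict : ∀ {n} {P Q : Pred (Fin n) 0ℓ} (P? : Decidable P) (Q? : Decidable Q)
                    {f : Fin n → ℚ} → P ⊆ Q → (∀ i → Q i → ¬ P i → f i ≡ 0ℚ) →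
                    sumWhere P? f ≡ sumWhere Q? f
sumWhere-restrict P? Q? {f} P⊆Q vanish = sum-cong-≗ pointwise
  where
  pointwise : ∀ i → (if does (P? i) then f i else 0ℚ) ≡ (if does (Q? i) then f i else 0ℚ)
  pointwise i with P? i | Q? i
  ... | yes _  | yes _  = refl
  ... | yes p  | no ¬q  = contradiction (P⊆Q p) ¬q
  ... | no ¬p  | yes q  = sym (vanish i q ¬p)
  ... | no _   | no _   = refl

sumWhere-cong : ∀ {n} {P : Pred (Fin n) 0ℓ} (P? : Decidable P) {f g : Fin n → ℚ} →
                f ≗ g → sumWhere P? f ≡ sumWhere P? g
sumWhere-cong P? f≗g =
  sum-cong-≗ (λ i → cong (λ x → if does (P? i) then x else 0ℚ) (f≗g i))

sumWhere-zero : ∀ {n} {P : Pred (Fin n) 0ℓ} (P? : Decidable P) {f : Fin n → ℚ} →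
                (∀ i → f i ≡ 0ℚ) → sumWhere P? f ≡ 0ℚ
sumWhere-zero {n} P? {f} f≡0 = trans (sum-cong-≗ pointwise) (sum-replicate-zero n)
  where
  pointwise : ∀ i → (if does (P? i) then f i else 0ℚ) ≡ 0ℚ
  pointwise i with P? i
  ... | yes _ = f≡0 i
  ... | no _  = refl

-- The case `zero` is the convention that a ratio over 0 is 0, so pairs without any optimal path
-- need no separate treatment.
ratio-zeroˡ : ∀ k → ratio 0 k ≡ 0ℚ
ratio-zeroˡ zero    = refl
ratio-zeroˡ (suc k) = ℚ.fromℚᵘ-cong {mkℚᵘ (+ 0) k} {mkℚᵘ (+ 0) 0} (*≡* refl)

1/m*1/n≡1/[m*n] : ∀ m n .{{_ : ℕ.NonZero m}} .{{_ : ℕ.NonZero n}}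
                  .{{_ : ℕ.NonZero (m ℕ.* n)}} →
                  (1ℤ / m) * (1ℤ / n) ≡ 1ℤ / (m ℕ.* n)
1/m*1/n≡1/[m*n] (suc m) (suc n) = ℚ.toℚᵘ-injective (begin
  toℚᵘ (fromℚᵘ x * fromℚᵘ y)             ≈⟨ ℚ.toℚᵘ-homo-* (fromℚᵘ x) (fromℚᵘ y) ⟩
  toℚᵘ (fromℚᵘ x) ℚᵘ.* toℚᵘ (fromℚᵘ y)   ≈⟨ ℚᵘ.*-cong (ℚ.toℚᵘ-fromℚᵘ x) (ℚ.toℚᵘ-fromℚᵘ y) ⟩
  -- Without reduction to lowest terms, `x ℚᵘ.* y` already has numerator 1 and denominator
  -- `suc m ℕ.* suc n`, so `fromℚᵘ` of it is the right-hand side by definition.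
  x ℚᵘ.* y                               ≈⟨ ℚ.toℚᵘ-fromℚᵘ (x ℚᵘ.* y) ⟨
  toℚᵘ (1ℤ / (suc m ℕ.* suc n))          ∎)
  where
  open import Relation.Binary.Reasoning.Setoid ℚᵘ.≃-setoid
  x = mkℚᵘ 1ℤ m
  y = mkℚᵘ 1ℤ n

𝔼-uniform : ∀ n .{{_ : ℕ.NonZero n}} (X : Fin n → ℚ) →
            𝔼 (uniform n) X ≡ (1ℤ / n) * sum X
-- Matching on `suc _` lets `uniform` unfold to its constant weight, which then factors out of the
-- sum.
𝔼-uniform n@(suc _) X = sym (*-distribˡ-sum (1ℤ / n) X)

module _ (G : TemporalGraph) where
  open TemporalGraph G

  σ-through-endpoint : ∀ ★ {s z v} → v ≡ s ⊎ v ≡ z → σ-through G ★ s z v ≡ 0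
  σ-through-endpoint ★ {s} {z} {v} v∈
    rewrite dec-true ((v Fin.≟ s) ⊎-dec (v Fin.≟ z)) v∈ = refl

  -- The pair dependency known from Brandes' algorithm; it is the summand common to `betweenness`
  -- and `estimator`.
  dependency : Criterion → V → V → V → ℚ
  dependency ★ v s z = ratio (σ-through G ★ s z v) (σ G ★ s z)

  dependency-endpoint : ∀ ★ {v s z} → v ≡ s ⊎ v ≡ z → dependency ★ v s z ≡ 0ℚ
  dependency-endpoint ★ {v} {s} {z} v∈ =
    trans (cong (λ m → ratio m (σ G ★ s z)) (σ-through-endpoint ★ v∈))
          (ratio-zeroˡ (σ G ★ s z))

  -- The condition on `z` has the same form as in `estimator`, which is therefore `1ℤ / (n ∸ 1)`
  -- times this sum by definition.
  totalDependency : Criterion → V → V → ℚ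
  totalDependency ★ v s = sumWhere (λ z → ¬? (z Fin.≟ s)) (dependency ★ v s)

  betweenness≡ : ∀ ★ v → betweenness G ★ v ≡
                 (1ℤ / (n ℕ.* (n ∸ 1))) * sum (totalDependency ★ v)
  betweenness≡ ★ v = cong ((1ℤ / (n ℕ.* (n ∸ 1))) *_) (trans
    (sumWhere-cong (λ s → ¬? (s Fin.≟ v)) dropTarget)
    -- `U?` always answers yes, so `sumWhere U?` computes to the plain `sum`.
    (sumWhere-restrict (λ s → ¬? (s Fin.≟ v)) U? _ dropSource))
    where
    dropTarget : ∀ s →
      sumWhere (λ z → ¬? (v Fin.≟ z) ×-dec ¬? (s Fin.≟ z)) (dependency ★ v s) ≡
      totalDependency ★ v s
    dropTarget s = sumWhere-restrict
      (λ z → ¬? (v Fin.≟ z) ×-dec ¬? (s Fin.≟ z)) (λ z → ¬? (z Fin.≟ s))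
      (λ (_ , s≢z) → s≢z ∘ sym)
      -- A target `z ≢ s` that fails the conjunction can only fail `v ≢ z`; decidability of equality
      -- turns this into `v ≡ z`.
      (λ z z≢s ¬both → dependency-endpoint ★
        (inj₂ (decidable-stable (v Fin.≟ z) (λ v≢z → ¬both (v≢z , z≢s ∘ sym)))))

    dropSource : ∀ s → _ → ¬ (¬ s ≡ v) → totalDependency ★ v s ≡ 0ℚ
    -- An excluded source is `v` itself, so every term of its inner sum has `v` as an endpoint.
    dropSource s _ ¬s≢v = sumWhere-zero (λ z → ¬? (z Fin.≟ s)) (λ z →
      dependency-endpoint ★ (inj₁ (sym (decidable-stable (s Fin.≟ v) ¬s≢v))))

lemma6 : (G : TemporalGraph) → let open TemporalGraph G in
    (★ : Criterion) (v : V) →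
    𝔼 (uniform n) (λ s → estimator G ★ v s) ≡ betweenness G ★ v
lemma6 G ★ v = begin
  𝔼 (uniform n) (estimator G ★ v)
    ≡⟨ 𝔼-uniform n (estimator G ★ v) ⟩
  (1ℤ / n) * sum (λ s → (1ℤ / (n ∸ 1)) * D s)
    ≡⟨ cong ((1ℤ / n) *_) (*-distribˡ-sum (1ℤ / (n ∸ 1)) D) ⟨
  (1ℤ / n) * ((1ℤ / (n ∸ 1)) * sum D)
    ≡⟨ ℚ.*-assoc (1ℤ / n) (1ℤ / (n ∸ 1)) (sum D) ⟨
  (1ℤ / n) * (1ℤ / (n ∸ 1)) * sum D
    ≡⟨ cong (_* sum D) (1/m*1/n≡1/[m*n] n (n ∸ 1)) ⟩
  (1ℤ / (n ℕ.* (n ∸ 1))) * sum D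
    ≡⟨ betweenness≡ G ★ v ⟨
  betweenness G ★ v ∎
  where
  open TemporalGraph G
  open ≡-Reasoning
  D = totalDependency G ★ v
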